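{- The functors $\coprod\colon[\mathbb{B},\mathbf{Set}]\to\mathbf{Nom}_{=}$ and $\mathcal{S}\colon\mathbf{Nom}_{=}\to[\mathbb{B},\mathbf{Set}]$ are an equivalence of categories: $[\mathbb{B},\mathbf{Set}]\simeq\mathbf{Nom}_{=}$.
   Context: $\mathbb{A}$ is a countably infinite set of names and $\mathrm{Perm}\,\mathbb{A}$ the group of finite permutations of $\mathbb{A}$. A nominal set is a $\mathrm{Perm}\,\mathbb{A}$-set in which every element has a finite support; $\operatorname{supp}x$ is the least finite support of $x$. $\mathbf{Nom}_{=}$ is the category of nominal sets and support-preserving equivariant maps, i.e. equivariant $f\colon X\to Y$ with $\operatorname{supp}f(x)=\operatorname{supp}x$ for all $x\in X$. $\mathbb{B}$ is the category of finite sets and bijections, identified with the equivalent small category of finite subsets of $\mathbb{A}$ and bijections; $[\mathbb{B},\mathbf{Set}]$ is its category of covariant presheaves. The functor $\coprod$ maps a presheaf $F$ to the nominal set $\coprod_{A\subseteq_{\mathrm{fin}}\mathbb{A}}FA$, with coproduct injections $\kappa_A$ and action $\pi\cdot\kappa_A(x)=\kappa_{\pi[A]}(F(\pi|_A^{\pi[A]})(x))$, where $\pi|_A^{\pi[A]}\colon A\cong\pi[A]$ is the restriction of $\pi$. The functor $\mathcal{S}$ maps a nominal set $X$ to the presheaf with $\mathcal{S}X(A)=\{x\in X\mid\operatorname{supp}x=A\}$ and $\mathcal{S}X(f)(x)=\pi_f\cdot x$, where $\pi_f\in\mathrm{Perm}\,\mathbb{A}$ is any permutation extending the bijection $f\colon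 A\cong B$; on morphisms it acts by restriction. -}

module Defs where

open import Level using (Level; _⊔_) renaming (suc to lsuc; zero to lzero)
open import Algebra.Bundles using (Group)
open import Axiom.ExcludedMiddle using (ExcludedMiddle)
open import Data.Empty using (⊥-elim)
open import Data.List.Base using (List; []; _∷_; _++_; map; filter)
open import Data.List.Extrema.Nat using (max; xs≤max)
open import Data.List.Membership.Propositional using (_∈_; _∉_)
open import Data.List.Membership.Propositional.Properties
  using (∈-map⁺; ∈-map⁻; ∈-++⁺ˡ; ∈-++⁺ʳ; ∈-filter⁺; ∈-filter⁻)
open import Data.List.Membership.Propositional.Properties.WithK using (unique⇒irrelevant)
import Data.List.Membership.DecPropositional as DecMembership
open import Data.List.Relation.Unary.All as All using (All; []; _∷_)
open import Data.List.Relation.Unary.AllPairs as AllPairs using (AllPairs; []; _∷_)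
import Data.List.Relation.Unary.AllPairs.Properties as AllPairsP
open import Data.List.Relation.Unary.Any using (here; there)
open import Data.Nat.Base using (ℕ; suc)
import Data.Nat.Base as ℕ
import Data.Nat.Properties as ℕ
open import Data.Product.Base using (Σ; ∃; _×_; _,_; proj₁; proj₂)
open import Function.Base using (_∘′_)
open import Function.Bundles using (_↔_; Inverse; mk↔ₛ′)
open import Function.Construct.Composition using (_↔-∘_)
open import Function.Construct.Identity using (↔-id)
open import Function.Construct.Symmetry using (↔-sym)
open import Function.Properties.Inverse using (↔⇒↣)
open import Relation.Binary.Core using (Rel)
open import Relation.Binary.Definitions using (DecidableEquality; tri<; tri≈; tri>)
open import Relation.Binary.PropositionalEquality
  using (_≡_; _≢_; refl; sym; trans; cong; subst; module ≡-Reasoning)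
open import Relation.Binary.PropositionalEquality.WithK using (≡-irrelevant)
open import Relation.Binary.Structures using (IsEquivalence)
open import Relation.Nullary.Decidable using (Dec; yes; no; via-injection; ¬?)
open import Relation.Nullary.Negation using (contradiction)

-- Equality of morphisms is part of the structure: for functions it is
-- pointwise equality, as function extensionality is not available.

record Category (o m e : Level) : Set (lsuc (o ⊔ m ⊔ e)) where
  no-eta-equality
  infix  4 _≈_
  infixr 9 _∘_
  field
    Obj       : Set o
    Hom       : Obj → Obj → Set m
    _≈_       : ∀ {A B} → Rel (Hom A B) e
    id        : ∀ {A} → Hom A A
    _∘_       : ∀ {A B C} → Hom B C → Hom A B → Hom A C
    equiv     : ∀ {A B} → IsEquivalence (_≈_ {A} {B})
    ∘-cong    : ∀ {A B C} {f g : Hom B C} {h k : Hom A B} →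
                f ≈ g → h ≈ k → f ∘ h ≈ g ∘ k
    identityˡ : ∀ {A B} {f : Hom A B} → id ∘ f ≈ f
    identityʳ : ∀ {A B} {f : Hom A B} → f ∘ id ≈ f
    assoc     : ∀ {A B C D} {f : Hom A B} {g : Hom B C} {h : Hom C D} →
                (h ∘ g) ∘ f ≈ h ∘ (g ∘ f)

  module Equiv {A B : Obj} = IsEquivalence (equiv {A} {B})

private
  variable
    o m e o′ m′ e′ : Level

record Functor (C : Category o m e) (D : Category o′ m′ e′)
               : Set (o ⊔ m ⊔ e ⊔ o′ ⊔ m′ ⊔ e′) where
  no-eta-equality
  private
    module C = Category C
    module D = Category D
  field
    F₀           : C.Obj → D.Obj
    F₁           : ∀ {A B} → C.Hom A B → D.Hom (F₀ A) (F₀ B)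
    F-resp-≈     : ∀ {A B} {f g : C.Hom A B} → f C.≈ g → F₁ f D.≈ F₁ g
    identity     : ∀ {A} → F₁ (C.id {A}) D.≈ D.id
    homomorphism : ∀ {A B E} {f : C.Hom A B} {g : C.Hom B E} →
                   F₁ (g C.∘ f) D.≈ F₁ g D.∘ F₁ f

idF : {C : Category o m e} → Functor C C
idF {C = C} = record
  { F₀ = λ A → A
  ; F₁ = λ f → f
  ; F-resp-≈ = λ p → p
  ; identity = Equiv.refl
  ; homomorphism = Equiv.refl
  }
  where open Category C

infixr 9 _∘F_

_∘F_ : ∀ {o″ m″ e″} {C : Category o m e} {D : Category o′ m′ e′} {E : Category o″ m″ e″} →
       Functor D E → Functor C D → Functor C E
_∘F_ {E = E} G F = record
  { F₀ = λ A → G.F₀ (F.F₀ A)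
  ; F₁ = λ f → G.F₁ (F.F₁ f)
  ; F-resp-≈ = λ p → G.F-resp-≈ (F.F-resp-≈ p)
  ; identity = Equiv.trans (G.F-resp-≈ F.identity) G.identity
  ; homomorphism = Equiv.trans (G.F-resp-≈ F.homomorphism) G.homomorphism
  }
  where
  module F = Functor F
  module G = Functor G
  open Category E

record NatTrans {C : Category o m e} {D : Category o′ m′ e′} (F G : Functor C D)
                : Set (o ⊔ m ⊔ m′ ⊔ e′) where
  no-eta-equality
  private
    module C = Category C
    module D = Category D
    module F = Functor F
    module G = Functor G
  field
    η       : ∀ A → D.Hom (F.F₀ A) (G.F₀ A)
    natural : ∀ {A B} (f : C.Hom A B) → η B D.∘ F.F₁ f D.≈ G.F₁ f D.∘ η A

record NaturalIsomorphism {C : Category o m e} {D : Category o′ m′ e′} (F G : Functor C D)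
                          : Set (o ⊔ m ⊔ m′ ⊔ e′) where
  private
    module D = Category D
  field
    to   : NatTrans F G
    from : NatTrans G F
  open NatTrans
  field
    from∘to : ∀ A → from .η A D.∘ to .η A D.≈ D.id
    to∘from : ∀ A → to .η A D.∘ from .η A D.≈ D.id

record IsEquivalenceOfCategories {C : Category o m e} {D : Category o′ m′ e′}
         (F : Functor C D) (G : Functor D C)
         : Set (o ⊔ m ⊔ e ⊔ o′ ⊔ m′ ⊔ e′) where
  field
    unit   : NaturalIsomorphism idF (G ∘F F)
    counit : NaturalIsomorphism (F ∘F G) idF

FunctorCategory : Category o m e → Category o′ m′ e′ →
                  Category (o ⊔ m ⊔ e ⊔ o′ ⊔ m′ ⊔ e′) (o ⊔ m ⊔ m′ ⊔ e′) (o ⊔ e′)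
FunctorCategory C D = record
  { Obj = Functor C D
  ; Hom = NatTrans
  ; _≈_ = λ α β → ∀ A → α .η A ≈ β .η A
  ; id = record
      { η = λ A → id
      ; natural = λ f → Equiv.trans identityˡ (Equiv.sym identityʳ)
      }
  ; _∘_ = λ β α → record
      { η = λ A → β .η A ∘ α .η A
      ; natural = λ f →
          Equiv.trans assoc
          (Equiv.trans (∘-cong Equiv.refl (α .natural f))
          (Equiv.trans (Equiv.sym assoc)
          (Equiv.trans (∘-cong (β .natural f) Equiv.refl)
          assoc)))
      }
  ; equiv = record
      { refl = λ A → Equiv.refl
      ; sym = λ p A → Equiv.sym (p A)
      ; trans = λ p q A → Equiv.trans (p A) (q A)
      }
  ; ∘-cong = λ p q A → ∘-cong (p A) (q A)
  ; identityˡ = λ A → identityˡ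
  ; identityʳ = λ A → identityʳ
  ; assoc = λ A → assoc
  }
  where
  open Category D
  open NatTrans

Sets : ∀ ℓ → Category (lsuc ℓ) ℓ ℓ
Sets ℓ = record
  { Obj = Set ℓ
  ; Hom = λ X Y → X → Y
  ; _≈_ = λ f g → ∀ x → f x ≡ g x
  ; id = λ x → x
  ; _∘_ = λ g f x → g (f x)
  ; equiv = record
      { refl = λ x → refl
      ; sym = λ p x → sym (p x)
      ; trans = λ p q x → trans (p x) (q x)
      }
  ; ∘-cong = λ {_} {_} {_} {f} p q x → trans (cong f (q x)) (p _)
  ; identityˡ = λ x → refl
  ; identityʳ = λ x → refl
  ; assoc = λ x → refl
  }

record GSet {c ℓ} (G : Group c ℓ) (x : Level) : Set (c ⊔ ℓ ⊔ lsuc x) where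
  no-eta-equality
  open Group G using (_≈_; _∙_; ε) renaming (Carrier to ∣G∣)
  infixr 6 _·_
  field
    Carrier : Set x
    _·_     : ∣G∣ → Carrier → Carrier
    ·-cong  : ∀ {g h} → g ≈ h → ∀ x → g · x ≡ h · x
    ε-·     : ∀ x → ε · x ≡ x
    ∙-·     : ∀ g h x → (g ∙ h) · x ≡ g · h · x

module Nominal (𝔸 : Set) (enum : 𝔸 ↔ ℕ) where

  private
    module E = Inverse enum

    code-injective : ∀ {a b} → E.to a ≡ E.to b → a ≡ b
    code-injective {a} {b} p =
      trans (sym (E.strictlyInverseʳ a)) (trans (cong E.from p) (E.strictlyInverseʳ b))

  _≟_ : DecidableEquality 𝔸
  _≟_ = via-injection (↔⇒↣ enum) ℕ._≟_

  private
    open module M = DecMembership _≟_ using (_∈?_)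

  -- A finite subset of 𝔸 is a list of names that is strictly increasing in
  -- the order given by the enumeration.  Each finite subset then has exactly
  -- one representation, so that _≡_ on FinSub is equality of sets (FinSub-ext).

  _<_ : 𝔸 → 𝔸 → Set
  a < b = E.to a ℕ.< E.to b

  record FinSub : Set where
    no-eta-equality
    pattern
    constructor finSub
    field
      elems  : List 𝔸
      sorted : AllPairs _<_ elems

  open FinSub

  infix 4 _∈ₛ_ _∉ₛ_ _⊆ₛ_

  _∈ₛ_ _∉ₛ_ : 𝔸 → FinSub → Set
  a ∈ₛ A = a ∈ elems A
  a ∉ₛ A = a ∉ elems A

  _⊆ₛ_ : FinSub → FinSub → Set
  A ⊆ₛ B = ∀ a → a ∈ₛ A → a ∈ₛ B

  private
    <-irrefl : ∀ {a} → a < a → ∀ {P : Set} → P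
    <-irrefl p = ⊥-elim (ℕ.<-irrefl refl p)

    tail-⊆ : ∀ {x xs ys} → AllPairs _<_ (x ∷ xs) →
             (∀ a → a ∈ x ∷ xs → a ∈ x ∷ ys) → ∀ a → a ∈ xs → a ∈ ys
    tail-⊆ (x< ∷ _) f a p with f a (there p)
    ... | here refl = <-irrefl (All.lookup x< p)
    ... | there q   = q

    sorted-ext : ∀ {xs ys} → AllPairs _<_ xs → AllPairs _<_ ys →
                 (∀ a → a ∈ xs → a ∈ ys) → (∀ a → a ∈ ys → a ∈ xs) → xs ≡ ys
    sorted-ext {[]}     {[]}     s t f g = refl
    sorted-ext {[]}     {y ∷ ys} s t f g with () ← g y (here refl)
    sorted-ext {x ∷ xs} {[]}     s t f g with () ← f x (here refl)
    sorted-ext {x ∷ xs} {y ∷ ys} s@(x< ∷ s′) t@(y< ∷ t′) f g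
      with f x (here refl) | g y (here refl)
    ... | there p | there q = <-irrefl (ℕ.<-trans (All.lookup y< p) (All.lookup x< q))
    ... | here refl | _ = cong (x ∷_) (sorted-ext s′ t′ (tail-⊆ s f) (tail-⊆ t g))
    ... | there p | here refl = <-irrefl (All.lookup y< p)

  FinSub-ext : ∀ {A B} → A ⊆ₛ B → B ⊆ₛ A → A ≡ B
  FinSub-ext {finSub xs s} {finSub ys t} f g with sorted-ext s t f g
  ... | refl = cong (finSub xs) (AllPairs.irrelevant ℕ.<-irrelevant s t)

  private
    insert : 𝔸 → List 𝔸 → List 𝔸
    insert a [] = a ∷ []
    insert a (x ∷ xs) with ℕ.<-cmp (E.to a) (E.to x)
    ... | tri< _ _ _ = a ∷ x ∷ xs
    ... | tri≈ _ _ _ = x ∷ xs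
    ... | tri> _ _ _ = x ∷ insert a xs

    ∈-insert⁻ : ∀ {b} a xs → b ∈ insert a xs → b ∈ a ∷ xs
    ∈-insert⁻ a [] p = p
    ∈-insert⁻ a (x ∷ xs) p with ℕ.<-cmp (E.to a) (E.to x)
    ∈-insert⁻ a (x ∷ xs) p         | tri< _ _ _ = p
    ∈-insert⁻ a (x ∷ xs) p         | tri≈ _ _ _ = there p
    ∈-insert⁻ a (x ∷ xs) (here p)  | tri> _ _ _ = there (here p)
    ∈-insert⁻ a (x ∷ xs) (there p) | tri> _ _ _ with ∈-insert⁻ a xs p
    ... | here q  = here q
    ... | there q = there (there q)

    ∈-insert⁺ : ∀ {b} a xs → b ∈ a ∷ xs → b ∈ insert a xs
    ∈-insert⁺ a [] p = p
    ∈-insert⁺ a (x ∷ xs) p with ℕ.<-cmp (E.to a) (E.to x)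
    ∈-insert⁺ a (x ∷ xs) p | tri< _ _ _ = p
    ∈-insert⁺ a (x ∷ xs) (here p)          | tri≈ _ q _ = here (trans p (code-injective q))
    ∈-insert⁺ a (x ∷ xs) (there p)         | tri≈ _ _ _ = p
    ∈-insert⁺ a (x ∷ xs) (here p)          | tri> _ _ _ = there (∈-insert⁺ a xs (here p))
    ∈-insert⁺ a (x ∷ xs) (there (here p))  | tri> _ _ _ = here p
    ∈-insert⁺ a (x ∷ xs) (there (there p)) | tri> _ _ _ = there (∈-insert⁺ a xs (there p))

    insert-sorted : ∀ a {xs} → AllPairs _<_ xs → AllPairs _<_ (insert a xs)
    insert-sorted a [] = [] ∷ []
    insert-sorted a {x ∷ xs} (x< ∷ s) with ℕ.<-cmp (E.to a) (E.to x)
    ... | tri< p _ _ = (p ∷ All.map (ℕ.<-trans p) x<) ∷ x< ∷ s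
    ... | tri≈ _ _ _ = x< ∷ s
    ... | tri> _ _ p = All.tabulate above ∷ insert-sorted a s
      where
      above : ∀ {b} → b ∈ insert a xs → x < b
      above q with ∈-insert⁻ a xs q
      ... | here refl = p
      ... | there r   = All.lookup x< r

  fromList : List 𝔸 → FinSub
  fromList []       = finSub [] []
  fromList (a ∷ as) = finSub (insert a (elems (fromList as)))
                             (insert-sorted a (sorted (fromList as)))

  ∈-fromList⁺ : ∀ {a} xs → a ∈ xs → a ∈ₛ fromList xs
  ∈-fromList⁺ (x ∷ xs) (here p)  = ∈-insert⁺ x (elems (fromList xs)) (here p)
  ∈-fromList⁺ (x ∷ xs) (there p) =
    ∈-insert⁺ x (elems (fromList xs)) (there (∈-fromList⁺ xs p))

  ∈-fromList⁻ : ∀ {a} xs → a ∈ₛ fromList xs → a ∈ xs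
  ∈-fromList⁻ (x ∷ xs) p with ∈-insert⁻ x (elems (fromList xs)) p
  ... | here q  = here q
  ... | there q = there (∈-fromList⁻ xs q)

  _∖_ : FinSub → 𝔸 → FinSub
  A ∖ a = finSub (filter (λ b → ¬? (b ≟ a)) (elems A)) (AllPairsP.filter⁺ _ (sorted A))

  private
    ∈-∖⁺ : ∀ {A a b} → b ∈ₛ A → b ≢ a → b ∈ₛ A ∖ a
    ∈-∖⁺ p q = ∈-filter⁺ _ p q

    ∈-∖⁻ : ∀ {A a b} → b ∈ₛ A ∖ a → b ∈ₛ A × b ≢ a
    ∈-∖⁻ {A} {a} p = ∈-filter⁻ (λ b → ¬? (b ≟ a)) {xs = elems A} p

  fresh : (xs : List 𝔸) → ∃ λ a → a ∉ xs
  fresh xs = E.from (suc n) , λ p →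
    ℕ.<-irrefl refl
      (ℕ.≤-trans (ℕ.≤-reflexive (sym (E.strictlyInverseˡ (suc n))))
                 (All.lookup (xs≤max 0 (map E.to xs)) (∈-map⁺ E.to p)))
    where n = max 0 (map E.to xs)

  -- The finite subset A regarded as a set: by El-≡, its elements are names.
  record El (A : FinSub) : Set where
    constructor _,_
    field
      name   : 𝔸
      member : name ∈ₛ A

  open El

  private
    <⇒≢ : ∀ {a b} → a < b → a ≢ b
    <⇒≢ p refl = <-irrefl p

  El-≡ : ∀ {A} {x y : El A} → name x ≡ name y → x ≡ y
  El-≡ {A} {a , p} {_ , q} refl =
    cong (a ,_) (unique⇒irrelevant (AllPairs.map <⇒≢ (sorted A)) p q)

  𝔹 : Category lzero lzero lzero
  𝔹 = record
    { Obj = FinSub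
    ; Hom = λ A B → El A ↔ El B
    ; _≈_ = λ f g → ∀ x → Inverse.to f x ≡ Inverse.to g x
    ; id = ↔-id _
    ; _∘_ = _↔-∘_
    ; equiv = record
        { refl = λ x → refl
        ; sym = λ p x → sym (p x)
        ; trans = λ p q x → trans (p x) (q x)
        }
    ; ∘-cong = λ {_} {_} {_} {f} p q x → trans (cong (Inverse.to f) (q x)) (p _)
    ; identityˡ = λ x → refl
    ; identityʳ = λ x → refl
    ; assoc = λ x → refl
    }

  Presheaves : ∀ ℓ → Category (lsuc ℓ) ℓ ℓ
  Presheaves ℓ = FunctorCategory 𝔹 (Sets ℓ)

  record FinPerm : Set where
    no-eta-equality
    field
      bijection : 𝔸 ↔ 𝔸
      moved     : List 𝔸
      unmoved   : ∀ a → a ∉ moved → Inverse.to bijection a ≡ a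

    open Inverse bijection public using (to; from)
      renaming (strictlyInverseˡ to to-from; strictlyInverseʳ to from-to)

    to-injective : ∀ {a b} → to a ≡ to b → a ≡ b
    to-injective {a} {b} p = trans (sym (from-to a)) (trans (cong from p) (from-to b))

    from-unmoved : ∀ a → a ∉ moved → from a ≡ a
    from-unmoved a p = trans (cong from (sym (unmoved a p))) (from-to a)

  open FinPerm

  -- The product π ∙ ρ applies ρ first.

  Perm : Group lzero lzero
  Perm = record
    { Carrier = FinPerm
    ; _≈_ = λ π ρ → ∀ a → to π a ≡ to ρ a
    ; _∙_ = λ π ρ → record
        { bijection = bijection π ↔-∘ bijection ρ
        ; moved = moved π ++ moved ρ
        ; unmoved = λ a p →
            trans (cong (to π) (unmoved ρ a (p ∘′ ∈-++⁺ʳ (moved π))))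
                  (unmoved π a (p ∘′ ∈-++⁺ˡ))
        }
    ; ε = record { bijection = ↔-id 𝔸 ; moved = [] ; unmoved = λ a p → refl }
    ; _⁻¹ = λ π → record
        { bijection = ↔-sym (bijection π) ; moved = moved π ; unmoved = from-unmoved π }
    ; isGroup = record
        { isMonoid = record
            { isSemigroup = record
                { isMagma = record
                    { isEquivalence = record
                        { refl = λ a → refl
                        ; sym = λ p a → sym (p a)
                        ; trans = λ p q a → trans (p a) (q a)
                        }
                    ; ∙-cong = λ {π} {_} {_} {ρ′} p q a → trans (cong (to π) (q a)) (p (to ρ′ a))
                    }
                ; assoc = λ π ρ σ a → refl
                }
            ; identity = (λ π a → refl) , (λ π a → refl)
            }
        ; inverse = from-to , to-from
        ; ⁻¹-cong = λ {π} {ρ} p a →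
            trans (cong (from π) (sym (trans (p (from ρ a)) (to-from ρ a))))
                  (from-to π (from ρ a))
        }
    }

  open Group Perm using (_∙_; ε; _⁻¹)

  private
    swap : 𝔸 → 𝔸 → 𝔸 → 𝔸
    swap a b c with c ≟ a
    ... | yes _ = b
    ... | no _ with c ≟ b
    ...   | yes _ = a
    ...   | no _  = c

    swap-left : ∀ a b → swap a b a ≡ b
    swap-left a b with a ≟ a
    ... | yes _ = refl
    ... | no q  = contradiction refl q

    swap-right : ∀ a b → swap a b b ≡ a
    swap-right a b with b ≟ a
    ... | yes p = p
    ... | no _ with b ≟ b
    ...   | yes _ = refl
    ...   | no q  = contradiction refl q

    swap-other : ∀ {a b c} → c ≢ a → c ≢ b → swap a b c ≡ c
    swap-other {a} {b} {c} p q with c ≟ a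
    ... | yes r = contradiction r p
    ... | no _ with c ≟ b
    ...   | yes r = contradiction r q
    ...   | no _  = refl

    swap-involutive : ∀ a b c → swap a b (swap a b c) ≡ c
    swap-involutive a b c = by-cases (c ≟ a) (c ≟ b)
      where
      by-cases : Dec (c ≡ a) → Dec (c ≡ b) → swap a b (swap a b c) ≡ c
      by-cases (yes refl) _ = trans (cong (swap a b) (swap-left a b)) (swap-right a b)
      by-cases (no _) (yes refl) = trans (cong (swap a b) (swap-right a b)) (swap-left a b)
      by-cases (no p) (no q) =
        trans (cong (swap a b) (swap-other p q)) (swap-other p q)

  transposition : 𝔸 → 𝔸 → FinPerm
  transposition a b = record
    { bijection = mk↔ₛ′ (swap a b) (swap a b) (swap-involutive a b) (swap-involutive a b)
    ; moved = a ∷ b ∷ []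
    ; unmoved = λ c p → swap-other (λ q → p (here q)) (λ q → p (there (here q)))
    }

  infix 9 _[_]

  _[_] : FinPerm → FinSub → FinSub
  π [ A ] = fromList (map (to π) (elems A))

  ∈-image⁺ : ∀ π A {a} → a ∈ₛ A → to π a ∈ₛ π [ A ]
  ∈-image⁺ π A p = ∈-fromList⁺ (map (to π) (elems A)) (∈-map⁺ (to π) p)

  ∈-image⁻ : ∀ π A {b} → b ∈ₛ π [ A ] → from π b ∈ₛ A
  ∈-image⁻ π A p with ∈-map⁻ (to π) (∈-fromList⁻ (map (to π) (elems A)) p)
  ... | a , q , refl = subst (_∈ₛ A) (sym (from-to π a)) q

  restrict : ∀ π A → El A ↔ El (π [ A ])
  restrict π A = mk↔ₛ′
    (λ (a , p) → to π a , ∈-image⁺ π A p)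
    (λ (b , q) → from π b , ∈-image⁻ π A q)
    (λ (b , q) → El-≡ (to-from π b))
    (λ (a , p) → El-≡ (from-to π a))

  private
    module _ {A B : FinSub} (f : El A ↔ El B) where
      private
        module f = Inverse f

      f-injective : ∀ {x y} → name (f.to x) ≡ name (f.to y) → name x ≡ name y
      f-injective {x} {y} p = cong name
        (trans (sym (f.strictlyInverseʳ x))
               (trans (cong f.from (El-≡ p)) (f.strictlyInverseʳ y)))

      extend′ : List (El A) → FinPerm
      extend′ []       = ε
      extend′ (x ∷ xs) =
        transposition (to (extend′ xs) (name x)) (name (f.to x)) ∙ extend′ xs

      extend′-extends : ∀ xs {x} → x ∈ xs → to (extend′ xs) (name x) ≡ name (f.to x)
      extend′-extends (y ∷ ys) (here refl) =
        swap-left (to (extend′ ys) (name y)) (name (f.to y))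
      extend′-extends (y ∷ ys) {x} (there p) with name x ≟ name y
      ... | yes q = trans (cong (to (extend′ (y ∷ ys))) q)
                          (trans (swap-left (to (extend′ ys) (name y)) (name (f.to y)))
                                 (cong (name ∘′ f.to) (El-≡ (sym q))))
      ... | no q  = trans (swap-other
                             (λ r → q (to-injective (extend′ ys) r))
                             (λ r → q (f-injective (trans (sym ih) r))))
                          ih
        where
        ih : to (extend′ ys) (name x) ≡ name (f.to x)
        ih = extend′-extends ys p

    attach : (A : FinSub) (xs : List 𝔸) → (∀ {a} → a ∈ xs → a ∈ₛ A) → List (El A)
    attach A []       f = []
    attach A (x ∷ xs) f = (x , f (here refl)) ∷ attach A xs (λ p → f (there p))

    ∈-attach : ∀ A xs (f : ∀ {a} → a ∈ xs → a ∈ₛ A) {x : El A} →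
               name x ∈ xs → x ∈ attach A xs f
    ∈-attach A (x ∷ xs) f (here p)  = here (El-≡ p)
    ∈-attach A (x ∷ xs) f (there p) = there (∈-attach A xs (λ q → f (there q)) p)

  -- A finite permutation extending a bijection f : A ≅ B, composed of
  -- transpositions; 𝒮-act-any shows that the choice does not matter.

  extend : ∀ {A B} → El A ↔ El B → FinPerm
  extend {A} f = extend′ f (attach A (elems A) (λ p → p))

  extend-extends : ∀ {A B} (f : El A ↔ El B) (x : El A) →
                   to (extend f) (name x) ≡ name (Inverse.to f x)
  extend-extends {A} f x =
    extend′-extends f (attach A (elems A) (λ p → p)) (∈-attach A (elems A) (λ p → p) (member x))

  module Support {ℓ} (X : GSet Perm ℓ) where
    open GSet X

    _supports_ : FinSub → Carrier → Set ℓ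
    A supports x = ∀ π → (∀ a → a ∈ₛ A → to π a ≡ a) → π · x ≡ x

    record IsLeastSupport (A : FinSub) (x : Carrier) : Set ℓ where
      no-eta-equality
      field
        isSupport : A supports x
        isLeast   : ∀ B → B supports x → A ⊆ₛ B

    open IsLeastSupport

    least-unique : ∀ {A B x} → IsLeastSupport A x → IsLeastSupport B x → A ≡ B
    least-unique {A} {B} s t =
      FinSub-ext {A} {B} (isLeast s B (isSupport t)) (isLeast t A (isSupport s))

    inv-· : ∀ π x → π ⁻¹ · π · x ≡ x
    inv-· π x = trans (sym (∙-· (π ⁻¹) π x))
                      (trans (·-cong {g = π ⁻¹ ∙ π} {h = ε} (from-to π) x) (ε-· x))

    ·-injective : ∀ π {x y} → π · x ≡ π · y → x ≡ y
    ·-injective π {x} {y} p = trans (sym (inv-· π x)) (trans (cong (π ⁻¹ ·_) p) (inv-· π y))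

    agree : ∀ {A x} → A supports x → ∀ π ρ → (∀ a → a ∈ₛ A → to π a ≡ to ρ a) →
            π · x ≡ ρ · x
    agree {A} {x} s π ρ p = ·-injective (ρ ⁻¹) (begin
      ρ ⁻¹ · π · x   ≡⟨ ∙-· (ρ ⁻¹) π x ⟨
      (ρ ⁻¹ ∙ π) · x ≡⟨ s (ρ ⁻¹ ∙ π) (λ a q → trans (cong (from ρ) (p a q)) (from-to ρ a)) ⟩
      x              ≡⟨ inv-· ρ x ⟨
      ρ ⁻¹ · ρ · x   ∎)
      where open ≡-Reasoning

    image-supports : ∀ π {A x} → A supports x → (π [ A ]) supports (π · x)
    image-supports π {A} {x} s ρ p = trans (sym (∙-· ρ π x))
      (agree {A} s (ρ ∙ π) π (λ a q → p (to π a) (∈-image⁺ π A q)))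

    image-least : ∀ π {A x} → IsLeastSupport A x → IsLeastSupport (π [ A ]) (π · x)
    image-least π {A} {x} s = record
      { isSupport = image-supports π {A} (isSupport s)
      ; isLeast = λ B t b q →
          subst (_∈ₛ B) (to-from π b)
            (∈-image⁻ (π ⁻¹) B
              (isLeast s ((π ⁻¹) [ B ])
                (subst (((π ⁻¹) [ B ]) supports_) (inv-· π x) (image-supports (π ⁻¹) {B} t))
                (from π b) (∈-image⁻ π A q)))
      }

    -- If A and C support x and a ∈ A ∖ C, then A ∖ a supports x.
    remove : ∀ {A C x} → A supports x → C supports x → ∀ {a} → a ∉ₛ C →
             (A ∖ a) supports x
    remove {A} {C} {x} s t {a} a∉C π p =
      ·-injective σ (begin
        σ · π · x       ≡⟨ cong (λ y → σ · π · y) σx ⟨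
        σ · π · σ · x   ≡⟨ cong (σ ·_) (∙-· π σ x) ⟨
        σ · (π ∙ σ) · x ≡⟨ ∙-· σ (π ∙ σ) x ⟨
        (σ ∙ (π ∙ σ)) · x ≡⟨ s (σ ∙ (π ∙ σ)) fix ⟩
        x               ≡⟨ σx ⟨
        σ · x           ∎)
      where
      open ≡-Reasoning
      ls = elems A ++ elems C ++ moved π
      b = proj₁ (fresh ls)
      b∉ = proj₂ (fresh ls)
      σ = transposition a b

      σx : σ · x ≡ x
      σx = t σ λ c q → swap-other
        (λ { refl → a∉C q })
        (λ { refl → b∉ (∈-++⁺ʳ (elems A) (∈-++⁺ˡ q)) })

      fix : ∀ c → c ∈ₛ A → swap a b (to π (swap a b c)) ≡ c
      fix c q with c ≟ a
      ... | yes refl = trans (cong (swap c b)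
                         (unmoved π b (λ r → b∉ (∈-++⁺ʳ (elems A) (∈-++⁺ʳ (elems C) r)))))
                       (swap-right c b)
      ... | no c≢a with c ≟ b
      ...   | yes refl = contradiction (∈-++⁺ˡ q) b∉
      ...   | no c≢b = trans (cong (swap a b) (p c (∈-∖⁺ {A} q c≢a))) (swap-other c≢a c≢b)

    module _ (em : ExcludedMiddle ℓ) (x : Carrier) where

      private
        shrink : (as : List 𝔸) (A : FinSub) → FinSub
        shrink []       A = A
        shrink (a ∷ as) A with em {(A ∖ a) supports x}
        ... | yes _ = shrink as (A ∖ a)
        ... | no _  = shrink as A

        shrink-supports : ∀ as {A} → A supports x → shrink as A supports x
        shrink-supports []       s = s
        shrink-supports (a ∷ as) {A} s with em {(A ∖ a) supports x}
        ... | yes t = shrink-supports as t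
        ... | no _  = shrink-supports as s

        shrink-⊆ : ∀ as A → shrink as A ⊆ₛ A
        shrink-⊆ []       A b p = p
        shrink-⊆ (a ∷ as) A b p with em {(A ∖ a) supports x}
        ... | yes _ = proj₁ (∈-∖⁻ {A} (shrink-⊆ as (A ∖ a) b p))
        ... | no _  = shrink-⊆ as A b p

        shrink-minimal : ∀ as A {C} → A supports x → C supports x →
                         ∀ {a} → a ∈ as → a ∈ₛ shrink as A → a ∈ₛ C
        shrink-minimal (a ∷ as) A {C} s t (here refl) q with em {(A ∖ a) supports x}
        ... | yes _ = contradiction refl (proj₂ (∈-∖⁻ {A} (shrink-⊆ as (A ∖ a) a q)))
        ... | no ¬r with a ∈? elems C
        ...   | yes a∈C = a∈C
        ...   | no  a∉C = contradiction (remove {A} {C} s t a∉C) ¬r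
        shrink-minimal (a ∷ as) A {C} s t (there p) q with em {(A ∖ a) supports x}
        ... | yes r = shrink-minimal as (A ∖ a) {C} r t p q
        ... | no _  = shrink-minimal as A {C} s t p q

      leastSupport : ∃ (_supports x) → ∃ λ A → IsLeastSupport A x
      leastSupport (A , s) = shrink (elems A) A , record
        { isSupport = shrink-supports (elems A) s
        ; isLeast = λ B t a p →
            shrink-minimal (elems A) A {B} s t (shrink-⊆ (elems A) A a p) p
        }

  record NominalSet (ℓ : Level) : Set (lsuc ℓ) where
    no-eta-equality
    field
      gset : GSet Perm ℓ
    open GSet gset public
    open Support gset public
    -- The witness is arbitrary, and morphisms do not refer to it.
    field
      finitelySupported : ∀ x → ∃ λ A → A supports x

  -- The theory of supports is classical: excluded middle is used (only) to
  -- compute the least finite support of an element from some finite support,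
  -- by deciding which finite sets support the element.

  module Classical {ℓ} (em : ExcludedMiddle ℓ) where

    module _ (X : NominalSet ℓ) where
      open NominalSet X

      supp : Carrier → FinSub
      supp x = proj₁ (leastSupport em x (finitelySupported x))

      supp-isLeastSupport : ∀ x → IsLeastSupport (supp x) x
      supp-isLeastSupport x = proj₂ (leastSupport em x (finitelySupported x))

      supp-unique : ∀ {A x} → IsLeastSupport A x → supp x ≡ A
      supp-unique s = least-unique (supp-isLeastSupport _) s

      supp-supports : ∀ x → supp x supports x
      supp-supports x = IsLeastSupport.isSupport (supp-isLeastSupport x)

    record Hom₌ (X Y : NominalSet ℓ) : Set ℓ where
      no-eta-equality
      private
        module X = NominalSet X
        module Y = NominalSet Y
      field
        fun         : X.Carrier → Y.Carrier
        equivariant : ∀ π x → fun (π X.· x) ≡ π Y.· fun x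
        supp-preserving : ∀ x → supp Y (fun x) ≡ supp X x

    open Hom₌

    Nom₌ : Category (lsuc ℓ) ℓ ℓ
    Nom₌ = record
      { Obj = NominalSet ℓ
      ; Hom = Hom₌
      ; _≈_ = λ f g → ∀ x → fun f x ≡ fun g x
      ; id = record
          { fun = λ x → x
          ; equivariant = λ π x → refl
          ; supp-preserving = λ x → refl
          }
      ; _∘_ = λ g f → record
          { fun = λ x → fun g (fun f x)
          ; equivariant = λ π x → trans (cong (fun g) (equivariant f π x)) (equivariant g π (fun f x))
          ; supp-preserving = λ x → trans (supp-preserving g (fun f x)) (supp-preserving f x)
          }
      ; equiv = record
          { refl = λ x → refl
          ; sym = λ p x → sym (p x)
          ; trans = λ p q x → trans (p x) (q x)
          }
      ; ∘-cong = λ {_} {_} {_} {f} p q x → trans (cong (fun f) (q x)) (p _)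
      ; identityˡ = λ x → refl
      ; identityʳ = λ x → refl
      ; assoc = λ x → refl
      }

    module _ (F : Functor 𝔹 (Sets ℓ)) where
      private
        module F = Functor F

      ∐-Carrier : Set ℓ
      ∐-Carrier = Σ FinSub F.F₀

      ∐-act : FinPerm → ∐-Carrier → ∐-Carrier
      ∐-act π (A , x) = π [ A ] , F.F₁ (restrict π A) x

      private
        ⊆-from-names : ∀ {A B C} (f : El A ↔ El B) (g : El A ↔ El C) →
          (∀ a → name (Inverse.to f a) ≡ name (Inverse.to g a)) → B ⊆ₛ C
        ⊆-from-names {A} {B} {C} f g p b q = subst (_∈ₛ C)
          (trans (sym (p (Inverse.from f (b , q))))
                 (cong name (Inverse.strictlyInverseˡ f (b , q))))
          (member (Inverse.to g (Inverse.from f (b , q))))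

      ∐-≡ : ∀ {A B C} (f : El A ↔ El B) (g : El A ↔ El C) →
            (∀ a → name (Inverse.to f a) ≡ name (Inverse.to g a)) → (x : F.F₀ A) →
            _≡_ {A = ∐-Carrier} (B , F.F₁ f x) (C , F.F₁ g x)
      ∐-≡ {A} {B} {C} f g p x
        with refl ← FinSub-ext {B} {C} (⊆-from-names {A} {B} {C} f g p)
                               (⊆-from-names {A} {C} {B} g f (λ a → sym (p a)))
        = cong (B ,_) (F.F-resp-≈ {f = f} {g} (λ a → El-≡ (p a)) x)

      private
        ∐-≡-id : ∀ {A B} (f : El A ↔ El B) → (∀ a → name (Inverse.to f a) ≡ name a) →
                 (x : F.F₀ A) → _≡_ {A = ∐-Carrier} (B , F.F₁ f x) (A , x)
        ∐-≡-id {A} f p x = trans (∐-≡ f (↔-id _) p x) (cong (A ,_) (F.identity x))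

      ∐-gset : GSet Perm ℓ
      ∐-gset .GSet.Carrier = ∐-Carrier
      ∐-gset .GSet._·_ = ∐-act
      ∐-gset .GSet.·-cong {π} {ρ} p (A , x) =
        ∐-≡ (restrict π A) (restrict ρ A) (λ a → p (name a)) x
      ∐-gset .GSet.ε-· (A , x) = ∐-≡-id (restrict ε A) (λ a → refl) x
      ∐-gset .GSet.∙-· π ρ (A , x) =
        trans (∐-≡ (restrict (π ∙ ρ) A) (restrict π (ρ [ A ]) ↔-∘ restrict ρ A) (λ a → refl) x)
              (cong (π [ ρ [ A ] ] ,_)
                    (F.homomorphism {f = restrict ρ A} {restrict π (ρ [ A ])} x))

      private
        module S = Support ∐-gset

      ∐-least : ∀ A (x : F.F₀ A) → S.IsLeastSupport A (A , x)
      ∐-least A x = record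
        { isSupport = λ π p → ∐-≡-id (restrict π A) (λ a → p (name a) (member a)) x
        ; isLeast = least
        }
        where
        least : ∀ B → B S.supports (A , x) → A ⊆ₛ B
        least B s a a∈A with a ∈? elems B
        ... | yes a∈B = a∈B
        ... | no  a∉B = contradiction (∈-++⁺ˡ b∈A) b∉
          where
          b = proj₁ (fresh (elems A ++ elems B))
          b∉ = proj₂ (fresh (elems A ++ elems B))
          σ = transposition a b
          σA : σ [ A ] ≡ A
          σA = cong proj₁ (s σ λ c q → swap-other
            (λ { refl → a∉B q })
            (λ { refl → b∉ (∈-++⁺ʳ (elems A) q) }))
          b∈A : b ∈ₛ A
          b∈A = subst (_∈ₛ A) (swap-left a b) (subst (swap a b a ∈ₛ_) σA (∈-image⁺ σ A a∈A))

      ∐₀ : NominalSet ℓ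
      ∐₀ .NominalSet.gset = ∐-gset
      ∐₀ .NominalSet.finitelySupported (A , x) =
        A , S.IsLeastSupport.isSupport (∐-least A x)

      ∐-supp : ∀ A x → supp ∐₀ (A , x) ≡ A
      ∐-supp A x = supp-unique ∐₀ (∐-least A x)

    ∐ : Functor (Presheaves ℓ) Nom₌
    ∐ = record
      { F₀ = ∐₀
      ; F₁ = λ {F} {G} α → record
          { fun = λ (A , x) → A , NatTrans.η α A x
          ; equivariant = λ π (A , x) →
              cong (π [ A ] ,_) (NatTrans.natural α (restrict π A) x)
          ; supp-preserving = λ (A , x) → trans (∐-supp G A _) (sym (∐-supp F A x))
          }
      ; F-resp-≈ = λ p (A , x) → cong (A ,_) (p A x)
      ; identity = λ x → refl
      ; homomorphism = λ x → refl
      }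

    module _ (X : NominalSet ℓ) where
      open NominalSet X

      𝒮-Carrier : FinSub → Set ℓ
      𝒮-Carrier A = Σ Carrier λ x → supp X x ≡ A

      𝒮-≡ : ∀ {A} {s t : 𝒮-Carrier A} → proj₁ s ≡ proj₁ t → s ≡ t
      𝒮-≡ {s = x , p} {_ , q} refl = cong (x ,_) (≡-irrelevant p q)

      extend-image : ∀ {A B} (f : El A ↔ El B) → extend f [ A ] ≡ B
      extend-image {A} {B} f = FinSub-ext
        (λ b p → let a = from π b , ∈-image⁻ π A p in
          subst (_∈ₛ B) (trans (sym (extend-extends f a)) (to-from π b))
                (member (Inverse.to f a)))
        (λ b p → let a = Inverse.from f (b , p) in
          subst (_∈ₛ π [ A ])
            (trans (extend-extends f a)
                   (cong name (Inverse.strictlyInverseˡ f (b , p))))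
            (∈-image⁺ π A (member a)))
        where π = extend f

      𝒮-act : ∀ {A B} → El A ↔ El B → 𝒮-Carrier A → 𝒮-Carrier B
      𝒮-act f (x , p) =
        extend f · x ,
        trans (supp-unique X (image-least (extend f) (supp-isLeastSupport X x)))
              (trans (cong (extend f [_]) p) (extend-image f))

      -- 𝒮 X f may be computed with any permutation extending f.
      𝒮-act-any : ∀ {A B} (f : El A ↔ El B) (s : 𝒮-Carrier A) π →
                  (∀ a → to π (name a) ≡ name (Inverse.to f a)) →
                  proj₁ (𝒮-act f s) ≡ π · proj₁ s
      𝒮-act-any f (x , refl) π p = agree {supp X x} (supp-supports X x) (extend f) π
        (λ a q → trans (extend-extends f (a , q)) (sym (p (a , q))))

      𝒮₀ : Functor 𝔹 (Sets ℓ)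
      𝒮₀ .Functor.F₀ = 𝒮-Carrier
      𝒮₀ .Functor.F₁ = 𝒮-act
      𝒮₀ .Functor.F-resp-≈ {f = f} {g} p s = 𝒮-≡
        (𝒮-act-any f s (extend g)
          (λ a → trans (extend-extends g a) (cong name (sym (p a)))))
      𝒮₀ .Functor.identity s = 𝒮-≡
        (trans (𝒮-act-any (↔-id _) s ε (λ a → refl)) (ε-· (proj₁ s)))
      𝒮₀ .Functor.homomorphism {f = f} {g} s = 𝒮-≡
        (trans (𝒮-act-any (g ↔-∘ f) s (extend g ∙ extend f)
                 (λ a → trans (cong (to (extend g)) (extend-extends f a))
                              (extend-extends g (Inverse.to f a))))
               (∙-· (extend g) (extend f) (proj₁ s)))

    𝒮 : Functor Nom₌ (Presheaves ℓ)
    𝒮 = record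
      { F₀ = 𝒮₀
      ; F₁ = λ {X} {Y} h → record
          { η = λ A (x , p) → fun h x , trans (supp-preserving h x) p
          ; natural = λ f (x , p) → 𝒮-≡ Y (equivariant h (extend f) x)
          }
      ; F-resp-≈ = λ {X} {Y} p A s → 𝒮-≡ Y (p (proj₁ s))
      ; identity = λ {X} A s → 𝒮-≡ X refl
      ; homomorphism = λ {X} {Y} {Z} A s → 𝒮-≡ Z refl
      }

{-# OPTIONS --safe #-}

-- The unit sends x ∈ FA to κ_A(x), and the counit sends κ_A(x), with supp x = A,
-- to x.  Their inverses rely on supports being determined: an element of
-- 𝒮(∐F)(A) is some κ_A′(x) with A′ = supp κ_A′(x) = A, and x comes from
-- κ_{supp x}(x).  In each category involved, the structure of a morphism
-- transfers to a two-sided inverse of its underlying function.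
module Submission where

open import Level using (Level)
open import Axiom.ExcludedMiddle using (ExcludedMiddle)
open import Data.Nat.Base using (ℕ)
open import Data.Product.Base using (_,_; proj₁; proj₂)
open import Function.Bundles using (_↔_)
open import Relation.Binary.PropositionalEquality
  using (_≡_; refl; sym; trans; cong; subst; module ≡-Reasoning)
open import Defs

private
  variable
    o m e o′ m′ e′ : Level

module _ {C : Category o m e} {D : Category o′ m′ e′} {F G : Functor C D} where
  private
    module C = Category C
    module F = Functor F
    module G = Functor G
  open Category D
  open NatTrans

  -- Inserting `α .η A ∘ β A` to the right of `G.F₁ f` lets naturality of `α` move `α` past `f`,
  -- where `β B` cancels it.
  inverse-natural : (α : NatTrans F G) (β : ∀ A → Hom (G.F₀ A) (F.F₀ A)) →
    (∀ A → β A ∘ α .η A ≈ id) → (∀ A → α .η A ∘ β A ≈ id) →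
    ∀ {A B} (f : C.Hom A B) → β B ∘ G.F₁ f ≈ F.F₁ f ∘ β A
  inverse-natural α β βα αβ {A} {B} f =
    Equiv.trans (Equiv.sym identityʳ)
    (Equiv.trans (∘-cong Equiv.refl (Equiv.sym (αβ A)))
    (Equiv.trans assoc
    (Equiv.trans (∘-cong Equiv.refl (Equiv.sym assoc))
    (Equiv.trans (∘-cong Equiv.refl (∘-cong (Equiv.sym (α .natural f)) Equiv.refl))
    (Equiv.trans (∘-cong Equiv.refl assoc)
    (Equiv.trans (Equiv.sym assoc)
    (Equiv.trans (∘-cong (βα B) Equiv.refl)
    identityˡ)))))))

  componentwise-iso : (α : NatTrans F G) (β : ∀ A → Hom (G.F₀ A) (F.F₀ A)) →
    (∀ A → β A ∘ α .η A ≈ id) → (∀ A → α .η A ∘ β A ≈ id) →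
    NaturalIsomorphism F G
  componentwise-iso α β βα αβ = record
    { to = α
    ; from = record { η = β ; natural = inverse-natural α β βα αβ }
    ; from∘to = βα
    ; to∘from = αβ
    }

module _ (𝔸 : Set) (enum : 𝔸 ↔ ℕ) {ℓ : Level} (em : ExcludedMiddle ℓ) where
  open Nominal 𝔸 enum
  open Classical em
  open NaturalIsomorphism using (from)
  open Hom₌

  inverse-Hom₌ : ∀ {X Y} (f : Hom₌ X Y) →
    (g : NominalSet.Carrier Y → NominalSet.Carrier X) →
    (∀ x → g (fun f x) ≡ x) → (∀ y → fun f (g y) ≡ y) → Hom₌ Y X
  inverse-Hom₌ {X} {Y} f g gf fg = record
    { fun = g
    ; equivariant = λ π y → begin
        g (π Y.· y)             ≡⟨ cong (λ z → g (π Y.· z)) (fg y) ⟨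
        g (π Y.· fun f (g y))   ≡⟨ cong g (equivariant f π (g y)) ⟨
        g (fun f (π X.· g y))   ≡⟨ gf (π X.· g y) ⟩
        π X.· g y               ∎
    -- Both supports equal that of `fun f (g y)`, which is `y`.
    ; supp-preserving = λ y →
        trans (sym (supp-preserving f (g y))) (cong (supp Y) (fg y))
    }
    where
    open ≡-Reasoning
    module X = NominalSet X
    module Y = NominalSet Y

  module _ (F : Functor 𝔹 (Sets ℓ)) where
    private
      module F = Functor F

    unit-η : NatTrans F (𝒮₀ (∐₀ F))
    unit-η = record
      { η = λ A x → (A , x) , ∐-supp F A x
      -- The indices `B` and `extend f [ A ]` are only propositionally equal, so `∐-≡` compares the
      -- two bijections out of `A` by names.
      ; natural = λ {A} f x → 𝒮-≡ (∐₀ F)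
          (∐-≡ F f (restrict (extend f) A) (λ a → sym (extend-extends f a)) x)
      }

    index-≡ : ∀ {A} (s : 𝒮-Carrier (∐₀ F) A) → proj₁ (proj₁ s) ≡ A
    index-≡ ((A , x) , p) = trans (sym (∐-supp F A x)) p

    unit-inverse : ∀ A → 𝒮-Carrier (∐₀ F) A → F.F₀ A
    unit-inverse A s = subst F.F₀ (index-≡ s) (proj₂ (proj₁ s))

    private
      -- On the image of `unit-η` the proof `index-≡` is a loop, but it goes through the computed
      -- support and need not reduce to `refl`; axiom K makes transport along it trivial.
      subst-loop : ∀ {A} (p : A ≡ A) (x : F.F₀ A) → subst F.F₀ p x ≡ x
      subst-loop refl x = refl

      subst-pair : ∀ {A B} (p : A ≡ B) (x : F.F₀ A) →
                   _≡_ {A = ∐-Carrier F} (B , subst F.F₀ p x) (A , x)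
      subst-pair refl x = refl

    unit-iso : NaturalIsomorphism F (𝒮₀ (∐₀ F))
    unit-iso = componentwise-iso unit-η unit-inverse
      (λ A x → subst-loop (index-≡ (NatTrans.η unit-η A x)) x)
      (λ A s → 𝒮-≡ (∐₀ F) (subst-pair (index-≡ s) (proj₂ (proj₁ s))))

  -- `componentwise-iso` acts on two levels: `unit-iso` made the inverse natural in `A`; here it
  -- becomes natural in `F`.
  unit : NaturalIsomorphism idF (𝒮 ∘F ∐)
  unit = componentwise-iso
    -- Both paths give `κ_A` of the image of `x` under `α`; only the support proofs differ.
    (record { η = unit-η ; natural = λ {F} {G} α A x → 𝒮-≡ (∐₀ G) refl })
    (λ F → from (unit-iso F))
    (λ F → NaturalIsomorphism.from∘to (unit-iso F))
    (λ F → NaturalIsomorphism.to∘from (unit-iso F))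

  module _ (X : NominalSet ℓ) where
    open NominalSet X

    counit-ε : Hom₌ (∐₀ (𝒮₀ X)) X
    counit-ε = record
      { fun = λ (A , x , p) → x
      -- `𝒮₀ X` acts on `restrict π A` through a chosen extension, but `π` is itself one.
      ; equivariant = λ π (A , s) → 𝒮-act-any X (restrict π A) s π (λ a → refl)
      ; supp-preserving = λ (A , x , p) → trans p (sym (∐-supp (𝒮₀ X) A (x , p)))
      }

    counit-inverse : Carrier → ∐-Carrier (𝒮₀ X)
    counit-inverse x = supp X x , x , refl

    counit-inverseˡ : ∀ s → counit-inverse (fun counit-ε s) ≡ s
    -- Matching the support proof turns the index into `supp X x`.
    counit-inverseˡ (_ , x , refl) = refl

  counit : NaturalIsomorphism (∐ ∘F 𝒮) idF
  counit = componentwise-iso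
    (record { η = counit-ε ; natural = λ f s → refl })
    (λ X → inverse-Hom₌ (counit-ε X) (counit-inverse X) (counit-inverseˡ X) (λ x → refl))
    counit-inverseˡ
    (λ X x → refl)

proposition7p4 : (𝔸 : Set) (enum : 𝔸 ↔ ℕ) {ℓ : Level} (em : ExcludedMiddle ℓ) →
    IsEquivalenceOfCategories (Nominal.Classical.∐ 𝔸 enum em) (Nominal.Classical.𝒮 𝔸 enum em)
proposition7p4 𝔸 enum em = record { unit = unit 𝔸 enum em ; counit = counit 𝔸 enum em }
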